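{- Let $\mathcal{G}$ be a parity game, let $T$ be a trap for Even in $\mathcal{G}$, and let $\mathcal{G}'=\mathcal{G}\cap T$ be the subgame induced by $T$. Let $d\ge 0$ be an even number such that all priorities in $\mathcal{G}$ are at most $d$. Then for every Even $d$-attractor decomposition $\mathcal{H}$ of $\mathcal{G}$, there is an Even $d$-attractor decomposition $\mathcal{H}'$ of $\mathcal{G}'$ such that the tree $\mathcal{T}_{\mathcal{H}}$ embeds the tree $\mathcal{T}_{\mathcal{H}'}$.
   Context: **Parity games.** A parity game $\mathcal{G}$ consists of a finite directed graph $(V,E)$ in which every vertex has at least one outgoing edge, a partition $(V_{\mathrm{Even}},V_{\mathrm{Odd}})$ of $V$, and a function $\pi$ assigning to each vertex a non-negative integer, its priority. For $S\subseteq V$, $\mathcal{G}\cap S$ is the substructure induced by $S$, and $\mathcal{G}\setminus S=\mathcal{G}\cap(V\setminus S)$; it is a subgame if every vertex of it has an outgoing edge inside it. The empty game is allowed as a subgame. **Strategies and traps.** An Even strategy is a set $\sigma\subseteq E$ such that every $v\in V_{\mathrm{Even}}$ has an outgoing edge in $\sigma$ and every outgoing edge of every $v\in V_{\mathrm{Odd}}$ is in $\sigma$. A set $T$ is a trap for Odd if there is an Even strategy $\sigma$ such that $w\in T$ and $(w,u)\in\sigma$ imply $u\in T$. Odd strategies and traps for Even are defined by swapping the players. The empty set counts as a trap. If $T$ is a trap then $\mathcal{G}\cap T$ is a subgame. **Attractors.** For $B\subseteq A\subseteq V$, an Even strategy $\sigma$ is an Even reachability strategy to $B$ from $A$ if every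 infinite path in $(V,\sigma)$ starting in $A$ contains a vertex of $B$. The Even attractor to $B$ in $\mathcal{G}$ is the largest set from which there is an Even reachability strategy to $B$ in $\mathcal{G}$. **Attractor decompositions.** Let $d\ge0$ be even and let $\mathcal{G}$ have all priorities at most $d$. An Even $d$-attractor decomposition of $\mathcal{G}$ is $\mathcal{H}=\langle A,(S_1,\mathcal{H}_1,A_1),\dots,(S_k,\mathcal{H}_k,A_k)\rangle$ such that $A$ is the Even attractor in $\mathcal{G}$ to the (possibly empty) set of vertices of priority $d$ and, setting $\mathcal{G}_1=\mathcal{G}\setminus A$, for all $i=1,\dots,k$: $S_i$ is a non-empty trap for Odd in $\mathcal{G}_i$ in which every priority is at most $d-2$; $\mathcal{H}_i$ is an Even $(d-2)$-attractor decomposition of $\mathcal{G}\cap S_i$; $A_i$ is the Even attractor to $S_i$ in $\mathcal{G}_i$; $\mathcal{G}_{i+1}=\mathcal{G}_i\setminus A_i$; and $\mathcal{G}_{k+1}$ is empty. If $d=0$ then $k=0$ is required. **Trees.** An ordered tree is the trivial tree $\langle\rangle$ or a finite sequence $\langle\mathcal{T}_1,\dots,\mathcal{T}_k\rangle$ of ordered trees. The tree of $\mathcal{H}$ is $\mathcal{T}_{\mathcal{H}}=\langle\rangle$ if $k=0$, and $\mathcal{T}_{\mathcal{H}}=\langle\mathcal{T}_{\mathcal{H}_1},\dots,\mathcal{T}_{\mathcal{H}_k}\rangle$ otherwise. Every ordered tree embeds $\langle\rangle$, and $\langle\mathcal{T}_1,\dots,\mathcal{T}_k\rangle$ embeds $\langle\mathcal{T}'_1,\dots,\mathcal{T}'_\ell\rangle$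 if there are $1\le i_1<\dots<i_\ell\le k$ such that $\mathcal{T}_{i_j}$ embeds $\mathcal{T}'_j$ for all $j=1,\dots,\ell$. -}

module Defs where

open import Data.Nat.Base using (ℕ; zero; suc; _≤_)
open import Data.Nat.Properties using (_≟_)
open import Data.Fin.Base using (Fin; _<_)
open import Data.Fin.Subset using (Subset; _∈_; _⊆_; _∩_; _─_; Nonempty; Empty)
open import Data.List.Base using (List; []; _∷_; length; lookup)
open import Data.Product.Base using (Σ; ∃; _×_; _,_)
open import Data.Vec.Base using (tabulate)
open import Relation.Binary.Core using (_Preserves_⟶_)
open import Relation.Binary.PropositionalEquality using (_≡_)
open import Relation.Nullary.Decidable using (⌊_⌋)

private
  variable
    n d : ℕ

data Player : Set where
  even odd : Player

opponent : Player → Player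
opponent even = odd
opponent odd  = even

-- A finite set of edges, given by the set of successors of each vertex:
-- the edge (v , w) belongs to σ iff w ∈ σ v.

EdgeSet : ℕ → Set
EdgeSet n = Fin n → Subset n

-- A finite directed graph with vertex set V ⊆ Fin n, an owner for each
-- vertex, and priorities.  The values of succ, owner and priority outside V
-- are irrelevant; the edges are the pairs satisfying _⊢_⟶_ below.
-- Letting V be a subset of Fin n makes restriction stay inside the same type.

record Structure (n : ℕ) : Set where
  constructor structure
  field
    V        : Subset n
    succ     : EdgeSet n
    owner    : Fin n → Player
    priority : Fin n → ℕ

open Structure public

infix 4 _⊢_⟶_

_⊢_⟶_ : Structure n → Fin n → Fin n → Set
𝒢 ⊢ v ⟶ w = v ∈ V 𝒢 × w ∈ V 𝒢 × w ∈ succ 𝒢 v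

IsParityGame : Structure n → Set
IsParityGame 𝒢 = ∀ {v} → v ∈ V 𝒢 → ∃ λ w → 𝒢 ⊢ v ⟶ w

PrioritiesAtMost : ℕ → Structure n → Set
PrioritiesAtMost d 𝒢 = ∀ {v} → v ∈ V 𝒢 → priority 𝒢 v ≤ d

priorityVertices : Structure n → ℕ → Subset n
priorityVertices 𝒢 d = V 𝒢 ∩ tabulate (λ v → ⌊ priority 𝒢 v ≟ d ⌋)

infixl 6 _⋒_ _∖_

-- The substructure induced by a set of vertices (𝒢 ∩ S in the usual notation).

_⋒_ : Structure n → Subset n → Structure n
𝒢 ⋒ S = record 𝒢 { V = V 𝒢 ∩ S }

_∖_ : Structure n → Subset n → Structure n
𝒢 ∖ S = 𝒢 ⋒ (V 𝒢 ─ S)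

record IsStrategy (P : Player) (𝒢 : Structure n) (σ : EdgeSet n) : Set where
  field
    edges    : ∀ {v w} → w ∈ σ v → 𝒢 ⊢ v ⟶ w
    own      : ∀ {v} → v ∈ V 𝒢 → owner 𝒢 v ≡ P → ∃ λ w → w ∈ σ v
    opposing : ∀ {v w} → owner 𝒢 v ≡ opponent P → 𝒢 ⊢ v ⟶ w → w ∈ σ v

-- T is a trap *for* P: it is the opponent of P who can stay in T forever.

IsTrapFor : Player → Structure n → Subset n → Set
IsTrapFor {n} P 𝒢 T =
  T ⊆ V 𝒢 ×
  Σ (EdgeSet n) λ σ →
    IsStrategy (opponent P) 𝒢 σ ×
    (∀ {w u} → w ∈ T → u ∈ σ w → u ∈ T)

InfinitePath : EdgeSet n → (ℕ → Fin n) → Set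
InfinitePath σ p = ∀ i → p (suc i) ∈ σ (p i)

record IsReachabilityStrategy (P : Player) (𝒢 : Structure n)
                              (B A : Subset n) (σ : EdgeSet n) : Set where
  field
    strategy : IsStrategy P 𝒢 σ
    reaches  : ∀ p → InfinitePath σ p → p zero ∈ A → ∃ λ i → p i ∈ B

Reachable : Player → Structure n → (B A : Subset n) → Set
Reachable {n} P 𝒢 B A =
  B ⊆ A × A ⊆ V 𝒢 × Σ (EdgeSet n) (IsReachabilityStrategy P 𝒢 B A)

IsAttractor : Player → Structure n → (B A : Subset n) → Set
IsAttractor P 𝒢 B A =
  Reachable P 𝒢 B A × (∀ A′ → Reachable P 𝒢 B A′ → A′ ⊆ A)

-- Even d-attractor decompositions; meant for even d and structures all of
-- whose priorities are at most d.  Layers d 𝒢ᵢ is the part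
-- (Sᵢ , ℋᵢ , Aᵢ) , … , (Sₖ , ℋₖ , Aₖ) of a decomposition, from 𝒢ᵢ onwards.
-- The index of layer forces k = 0 when d = 0.

mutual

  data Decomposition {n} (d : ℕ) (𝒢 : Structure n) : Set where
    ⟨_,_,_⟩ : (A : Subset n) →
              IsAttractor even 𝒢 (priorityVertices 𝒢 d) A →
              Layers d (𝒢 ∖ A) →
              Decomposition d 𝒢

  data Layers {n} : ℕ → Structure n → Set where
    done  : ∀ {d 𝒢} → Empty (V 𝒢) → Layers d 𝒢
    layer : ∀ {d 𝒢} (S : Subset n) →
            Nonempty S →
            IsTrapFor odd 𝒢 S →
            PrioritiesAtMost d (𝒢 ⋒ S) →
            (ℋ : Decomposition d (𝒢 ⋒ S)) →
            (A : Subset n) →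
            IsAttractor even 𝒢 S A →
            Layers (suc (suc d)) (𝒢 ∖ A) →
            Layers (suc (suc d)) 𝒢

data Tree : Set where
  node : List Tree → Tree

infix 4 _Embeds_

data _Embeds_ : Tree → Tree → Set where
  trivial : ∀ {t} → t Embeds node []
  embed   : ∀ {ts us} (f : Fin (length us) → Fin (length ts)) →
            f Preserves _<_ ⟶ _<_ →
            (∀ j → lookup ts (f j) Embeds lookup us j) →
            node ts Embeds node us

mutual

  tree : {𝒢 : Structure n} → Decomposition d 𝒢 → Tree
  tree ⟨ _ , _ , ls ⟩ = node (subtrees ls)

  subtrees : {𝒢 : Structure n} → Layers d 𝒢 → List Tree
  subtrees (done _)                 = []
  subtrees (layer _ _ _ _ ℋ _ _ ls) = tree ℋ ∷ subtrees ls

{-# OPTIONS --safe #-}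

-- Write 𝒢′ for the part of the game inside the trap.  Layer by layer, replace
-- Sᵢ by its intersection with what is left of 𝒢′ and Aᵢ by the attractor A′
-- to this intersection inside 𝒢′; layers with an empty intersection are
-- dropped.  From a vertex of 𝒢′ outside A′, Odd can stay in 𝒢′ ∖ A′, a set
-- that is disjoint from Sᵢ; hence Even has no way to force a visit to Sᵢ, so
-- 𝒢′ ∖ A′ is disjoint from Aᵢ and is again a trap in the rest of 𝒢.

module Submission where

open import Defs
open import Data.Nat.Base using (ℕ; zero; suc; z<s; s<s)
open import Data.Nat.Divisibility using (_∣_)
open import Data.Fin.Base using (Fin; zero; suc; lift)
open import Data.Fin.Properties using (_≟_; any?)
open import Data.Fin.Subset
  using (Subset; inside; outside; _∈_; _∉_; _⊆_; _⊃_; _∩_; _∪_; _─_; ⁅_⁆; ⊥; Nonempty; Empty)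
open import Data.Fin.Subset.Properties
  using ( _∈?_; nonempty?; ∉⊥; p∩q⊆p; p∩q⊆q; x∈p∩q⁺; p⊆p∪q; q⊆p∪q; x∈p∪q⁻
        ; x∈p∧x∉q⇒x∈p─q; p─q⊆p; x∈⁅x⁆; x∈⁅y⁆⇒x≡y)
open import Data.Fin.Subset.Induction using (Acc; acc; ⊃-wellFounded)
open import Data.List.Base using (List; _∷_)
open import Data.Product.Base using (Σ; ∃; _×_; _,_; proj₁; proj₂)
open import Data.Sum.Base using (_⊎_; inj₁; inj₂)
open import Data.Vec.Base using (here; there; _∷_)
open import Data.Vec.Functional using (updateAt)
open import Data.Vec.Functional.Properties using (updateAt-updates; updateAt-minimal)
open import Function.Base using (const; id; _∘_)
open import Relation.Binary.PropositionalEquality using (_≡_; refl; sym; subst)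
open import Relation.Nullary using (¬_; Dec; yes; no; contradiction)
open import Relation.Nullary.Decidable using (_×-dec_; ¬?)

private
  variable
    n d : ℕ
    v : Fin n
    t u : Tree
    ts us : List Tree
    𝒢 : Structure n
    ρ τ : EdgeSet n
    A A′ B S U W : Subset n

-- Set difference and tree embeddings.

∈─⇒∉ : (p q : Subset n) → v ∈ p ─ q → v ∉ q
∈─⇒∉ (inside ∷ p) (outside ∷ q) here      ()
∈─⇒∉ (_ ∷ p)      (inside  ∷ q) (there x) (there y) = ∈─⇒∉ p q x y
∈─⇒∉ (_ ∷ p)      (outside ∷ q) (there x) (there y) = ∈─⇒∉ p q x y

embeds-skip : node ts Embeds node us → node (t ∷ ts) Embeds node us
embeds-skip trivial            = trivial
embeds-skip (embed f f-mono e) = embed (suc ∘ f) (s<s ∘ f-mono) e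

embeds-cons : t Embeds u → node ts Embeds node us → node (t ∷ ts) Embeds node (u ∷ us)
embeds-cons e trivial =
  -- Here `us` is empty, so `u` is the only child to match and goes to the first position.
  embed (λ _ → zero) (λ { {zero} {zero} () }) (λ { zero → e })
embeds-cons e (embed f f-mono es) =
  embed (lift 1 f)
        (λ { {zero} {zero} () ; {zero} {suc _} _ → z<s ; {suc _} {suc _} (s<s i<j) → s<s (f-mono i<j) })
        (λ { zero → e ; (suc j) → es j })

-- Overwriting the vertex set, instead of intersecting with it, makes iterated restrictions
-- collapse: `restrict (𝒢 ∖ A) W` is `restrict 𝒢 W` by definition. This lets the recursion on layers
-- go through without transport.
restrict : Structure n → Subset n → Structure n
restrict 𝒢 U = record 𝒢 { V = U }

-- Traps for Even.

-- U is a trap for Even, without mention of Odd's behaviour outside U.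
record Confined (𝒢 : Structure n) (U : Subset n) : Set where
  field
    subset : U ⊆ V 𝒢
    total  : ∀ {v} → v ∈ U → ∃ λ w → w ∈ U × w ∈ succ 𝒢 v
    closed : ∀ {v w} → owner 𝒢 v ≡ even → v ∈ U → w ∈ V 𝒢 → w ∈ succ 𝒢 v → w ∈ U

open Confined
open IsStrategy
open IsReachabilityStrategy

-- Odd's strategy contains every edge at Even's vertices, whence `closed`. Successors inside the
-- trap come from `live` at Even's vertices and from the strategy at Odd's.
trap⇒confined : IsParityGame 𝒢 → IsTrapFor even 𝒢 U → Confined 𝒢 (V 𝒢 ∩ U)
trap⇒confined {𝒢 = 𝒢} {U = U} live (U⊆V , σ , strat , stay) = record
  { subset = p∩q⊆p _ _
  ; total  = tot
  ; closed = λ eq v∈U w∈V w∈succ → x∈p∩q⁺ (w∈V , stay (p∩q⊆q _ _ v∈U)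
               (opposing strat eq (p∩q⊆p _ _ v∈U , w∈V , w∈succ)))
  }
  where
  tot : ∀ {v} → v ∈ V 𝒢 ∩ U → ∃ λ w → w ∈ V 𝒢 ∩ U × w ∈ succ 𝒢 v
  tot {v} v∈U with p∩q⊆p _ _ v∈U | p∩q⊆q (V 𝒢) _ v∈U | owner 𝒢 v in eq
  ... | v∈V | v∈T | even = let w , _ , w∈V , w∈succ = live v∈V in
    w , x∈p∩q⁺ (w∈V , stay v∈T (opposing strat eq (v∈V , w∈V , w∈succ))) , w∈succ
  ... | v∈V | v∈T | odd = let w , w∈σ = own strat v∈V eq ; _ , w∈V , w∈succ = edges strat w∈σ in
    w , x∈p∩q⁺ (w∈V , stay v∈T w∈σ) , w∈succ

confined-isParityGame : Confined 𝒢 U → IsParityGame (restrict 𝒢 U)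
confined-isParityGame c v∈U = let w , w∈U , w∈succ = total c v∈U in w , v∈U , w∈U , w∈succ

confined-trans : Confined 𝒢 U → Confined (restrict 𝒢 U) W → Confined 𝒢 W
confined-trans c c′ = record
  { subset = subset c ∘ subset c′
  ; total  = total c′
  ; closed = λ eq v∈W w∈V w∈succ →
      closed c′ eq v∈W (closed c eq (subset c′ v∈W) w∈V w∈succ) w∈succ
  }

-- At Even's vertices the strategy for staying in `S` offers an edge, which `closed` keeps in `U`;
-- at Odd's, `total` offers an edge in `U`, which cannot leave `S`. The set `U ∩ (U ∩ S)` is
-- literally the vertex set of `restrict 𝒢 U ⋒ (U ∩ S)`.
confined-∩-trap : Confined 𝒢 U → IsTrapFor odd 𝒢 S → Confined (𝒢 ⋒ S) (U ∩ (U ∩ S))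
confined-∩-trap {𝒢 = 𝒢} {U = U} {S = S} c (S⊆V , σ , strat , stay) = record
  { subset = λ v∈ → x∈p∩q⁺ (subset c (p∩q⊆p _ _ v∈) , S-part v∈)
  ; total  = tot
  ; closed = λ eq v∈ w∈ w∈succ → both (closed c eq (p∩q⊆p _ _ v∈) (p∩q⊆p _ _ w∈) w∈succ) (p∩q⊆q _ _ w∈)
  }
  where
  both : ∀ {v} → v ∈ U → v ∈ S → v ∈ U ∩ (U ∩ S)
  both v∈U v∈S = x∈p∩q⁺ (v∈U , x∈p∩q⁺ (v∈U , v∈S))

  S-part : U ∩ (U ∩ S) ⊆ S
  S-part = p∩q⊆q _ _ ∘ p∩q⊆q U (U ∩ S)

  tot : ∀ {v} → v ∈ U ∩ (U ∩ S) → ∃ λ w → w ∈ U ∩ (U ∩ S) × w ∈ succ 𝒢 v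
  tot {v} v∈ with p∩q⊆p _ _ v∈ | S-part v∈ | owner 𝒢 v in eq
  ... | v∈U | v∈S | even = let w , w∈σ = own strat (S⊆V v∈S) eq ; _ , w∈V , w∈succ = edges strat w∈σ in
    w , both (closed c eq v∈U w∈V w∈succ) (stay v∈S w∈σ) , w∈succ
  ... | v∈U | v∈S | odd = let w , w∈U , w∈succ = total c v∈U in
    w , both w∈U (stay v∈S (opposing strat eq (S⊆V v∈S , subset c w∈U , w∈succ))) , w∈succ

-- Strategies and reachability inside a trap.

infix 7 _↾_

_↾_ : EdgeSet n → Subset n → EdgeSet n
(σ ↾ U) v with v ∈? U
... | yes _ = U ∩ σ v
... | no  _ = ⊥

↾⁻ : ∀ (σ : EdgeSet n) U {v w} → w ∈ (σ ↾ U) v → v ∈ U × w ∈ U × w ∈ σ v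
↾⁻ σ U {v} w∈ with v ∈? U
... | yes v∈U = v∈U , p∩q⊆p _ _ w∈ , p∩q⊆q _ _ w∈
... | no  _   = contradiction w∈ ∉⊥

↾⁺ : ∀ (σ : EdgeSet n) U {v w} → v ∈ U → w ∈ U → w ∈ σ v → w ∈ (σ ↾ U) v
↾⁺ σ U {v} v∈U w∈U w∈σ with v ∈? U
... | yes _   = x∈p∩q⁺ (w∈U , w∈σ)
... | no  v∉U = contradiction v∈U v∉U

allEdges-isStrategy : IsParityGame 𝒢 → IsStrategy even 𝒢 (succ 𝒢 ↾ V 𝒢)
allEdges-isStrategy {𝒢 = 𝒢} live = record
  { edges    = ↾⁻ (succ 𝒢) (V 𝒢)
  ; own      = λ v∈V _ → let w , _ , w∈V , w∈succ = live v∈V in w , ↾⁺ _ _ v∈V w∈V w∈succ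
  ; opposing = λ _ (v∈V , w∈V , w∈succ) → ↾⁺ _ _ v∈V w∈V w∈succ
  }

-- Even's choices survive because no edge at a vertex of Even leaves `U`.
↾-isStrategy : Confined 𝒢 U → IsStrategy even 𝒢 ρ → IsStrategy even (restrict 𝒢 U) (ρ ↾ U)
↾-isStrategy {U = U} {ρ = σ} c strat = record
  { edges    = λ w∈ → let v∈U , w∈U , w∈σ = ↾⁻ σ U w∈ in
                      v∈U , w∈U , proj₂ (proj₂ (edges strat w∈σ))
  ; own      = λ v∈U eq → let w , w∈σ = own strat (subset c v∈U) eq
                              _ , w∈V , w∈succ = edges strat w∈σ in
                          w , ↾⁺ _ _ v∈U (closed c eq v∈U w∈V w∈succ) w∈σ
  ; opposing = λ eq (v∈U , w∈U , w∈succ) →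
                 ↾⁺ _ _ v∈U w∈U (opposing strat eq (subset c v∈U , subset c w∈U , w∈succ))
  }

trap-restrict : Confined 𝒢 U → IsTrapFor odd 𝒢 S → IsTrapFor odd (restrict 𝒢 U) (U ∩ S)
trap-restrict {U = U} c (_ , σ , strat , stay) =
  p∩q⊆p _ _ , σ ↾ U , ↾-isStrategy c strat ,
  λ w∈ u∈ → let _ , u∈U , u∈σ = ↾⁻ σ U u∈ in x∈p∩q⁺ (u∈U , stay (p∩q⊆q _ _ w∈) u∈σ)

-- From a common vertex of `U` and `A`, Odd could answer the reachability strategy by staying in
-- `U`, producing an infinite path that avoids `B`.
confined-reachable-disjoint : Reachable even 𝒢 B A → Confined 𝒢 U →
  (∀ {v} → v ∈ U → v ∉ B) → ∀ {v} → v ∈ U → v ∉ A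
confined-reachable-disjoint {𝒢 = 𝒢} {U = U} (_ , _ , σ , r) c U∩B=∅ {v₀} v₀∈U v₀∈A =
  let i , pᵢ∈B = reaches r (proj₁ ∘ path) (proj₁ ∘ proj₂ ∘ step ∘ path) v₀∈A
  in U∩B=∅ (proj₂ (path i)) pᵢ∈B
  where
  step : ((v , _) : Σ (Fin _) (_∈ U)) → ∃ λ w → w ∈ σ v × w ∈ U
  -- At Even's vertices every edge of `σ` stays in `U`; at Odd's, the edge that stays in `U` belongs
  -- to `σ`, which contains all of Odd's edges.
  step (v , v∈U) with owner 𝒢 v in eq
  ... | even = let w , w∈σ = own (strategy r) (subset c v∈U) eq
                   _ , w∈V , w∈succ = edges (strategy r) w∈σ
               in w , w∈σ , closed c eq v∈U w∈V w∈succ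
  ... | odd  = let w , w∈U , w∈succ = total c v∈U
               in w , opposing (strategy r) eq (subset c v∈U , subset c w∈U , w∈succ) , w∈U

  path : ℕ → Σ (Fin _) (_∈ U)
  path zero    = v₀ , v₀∈U
  path (suc i) = let w , _ , w∈U = step (path i) in w , w∈U

confined-∖ : Reachable even 𝒢 B A → Confined 𝒢 U → (∀ {v} → v ∈ U → v ∉ B) → Confined (𝒢 ∖ A) U
confined-∖ r c U∩B=∅ = record
  { subset = λ v∈U → x∈p∩q⁺ (subset c v∈U ,
      x∈p∧x∉q⇒x∈p─q (subset c v∈U) (confined-reachable-disjoint r c U∩B=∅ v∈U))
  ; total  = total c
  ; closed = λ eq v∈U w∈V → closed c eq v∈U (p∩q⊆p _ _ w∈V)
  }

-- Construction of attractors.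

-- Every path of σ visits B, and stays in A until it does.  The latter makes
-- the predicate insensitive to changes of σ outside A.
data Forced (σ : EdgeSet n) (B A : Subset n) (v : Fin n) : Set where
  now   : v ∈ B → Forced σ B A v
  later : v ∈ A → (∀ {w} → w ∈ σ v → Forced σ B A w) → Forced σ B A v

Forced-reaches : Forced ρ B A v → ∀ p → InfinitePath ρ p → p zero ≡ v → ∃ λ i → p i ∈ B
Forced-reaches (now v∈B)   p path refl = zero , v∈B
Forced-reaches (later _ f) p path refl =
  let i , pᵢ∈B = Forced-reaches (f (path zero)) (p ∘ suc) (path ∘ suc) refl in suc i , pᵢ∈B

Forced-mono : A ⊆ A′ → (∀ {v} → v ∈ A → τ v ⊆ ρ v) → Forced ρ B A v → Forced τ B A′ v
Forced-mono A⊆A′ τ⊆ρ (now v∈B)     = now v∈B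
Forced-mono A⊆A′ τ⊆ρ (later v∈A f) =
  later (A⊆A′ v∈A) (λ w∈τ → Forced-mono A⊆A′ τ⊆ρ (f (τ⊆ρ v∈A w∈τ)))

-- An inductive counterpart of `Reachable`: with `Forced` in place of infinite paths, it can be
-- extended by one vertex at a time.
record Attracting (𝒢 : Structure n) (B A : Subset n) : Set where
  field
    B⊆A    : B ⊆ A
    A⊆V    : A ⊆ V 𝒢
    σ      : EdgeSet n
    strat  : IsStrategy even 𝒢 σ
    forced : ∀ {v} → v ∈ A → Forced σ B A v

attracting⇒reachable : Attracting 𝒢 B A → Reachable even 𝒢 B A
attracting⇒reachable a = B⊆A , A⊆V , σ , record
  { strategy = strat ; reaches = λ p path p₀∈A → Forced-reaches (forced p₀∈A) p path refl }
  where open Attracting a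

-- The controllable predecessor of `A` for Even, which supplies the next vertex in the attractor
-- computation.
Attracts : Structure n → Subset n → Fin n → Set
Attracts 𝒢 A v = (owner 𝒢 v ≡ even × Nonempty (succ 𝒢 v ∩ A))
               ⊎ (owner 𝒢 v ≡ odd × Empty ((V 𝒢 ∩ succ 𝒢 v) ─ A))

attracts? : ∀ (𝒢 : Structure n) A v → Dec (Attracts 𝒢 A v)
attracts? 𝒢 A v with owner 𝒢 v
... | even with nonempty? (succ 𝒢 v ∩ A)
...   | yes p = yes (inj₁ (refl , p))
...   | no ¬p = no λ { (inj₁ (_ , p)) → ¬p p }
attracts? 𝒢 A v | odd with nonempty? ((V 𝒢 ∩ succ 𝒢 v) ─ A)
...   | yes p = no λ { (inj₂ (_ , ¬p)) → ¬p p }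
...   | no ¬p = yes (inj₂ (refl , ¬p))

-- The strategy changes only at `u`, where it becomes the set of edges into `A`. Old derivations of
-- `Forced` survive, since they consult the strategy only inside `A` and `u` lies outside.
attracting-extend : ∀ {u} → Attracting 𝒢 B A → u ∈ V 𝒢 → u ∉ A → Attracts 𝒢 A u →
  Attracting 𝒢 B (A ∪ ⁅ u ⁆)
attracting-extend {𝒢 = 𝒢} {B = B} {A = A} {u = u} a u∈V u∉A attracts = record
  { B⊆A    = p⊆p∪q _ ∘ B⊆A
  ; A⊆V    = A∪u⊆V
  ; σ      = σ′
  ; strat  = record { edges = edges′ ; own = own′ ; opposing = opposing′ }
  ; forced = forced′
  }
  where
  open Attracting a

  σ′ : EdgeSet _
  σ′ = updateAt σ u (const (succ 𝒢 u ∩ A))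

  σ′-new : σ′ u ≡ succ 𝒢 u ∩ A
  σ′-new = updateAt-updates u σ

  σ′-old : ∀ {v} → ¬ v ≡ u → σ′ v ≡ σ v
  σ′-old v≢u = updateAt-minimal _ u σ v≢u

  A∪u⊆V : A ∪ ⁅ u ⁆ ⊆ V 𝒢
  A∪u⊆V v∈ with x∈p∪q⁻ A ⁅ u ⁆ v∈
  ... | inj₁ v∈A = A⊆V v∈A
  ... | inj₂ v∈u with refl ← x∈⁅y⁆⇒x≡y u v∈u = u∈V

  edges′ : ∀ {v w} → w ∈ σ′ v → 𝒢 ⊢ v ⟶ w
  edges′ {v} {w} w∈ with v ≟ u
  ... | no v≢u = edges strat (subst (w ∈_) (σ′-old v≢u) w∈)
  ... | yes refl with w∈R ← subst (w ∈_) σ′-new w∈ = u∈V , A⊆V (p∩q⊆q _ _ w∈R) , p∩q⊆p _ _ w∈R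

  own-new : Attracts 𝒢 A u → owner 𝒢 u ≡ even → Nonempty (succ 𝒢 u ∩ A)
  own-new (inj₁ (_ , ne))  _  = ne
  own-new (inj₂ (eq′ , _)) eq rewrite eq with () ← eq′

  opposing-new : Attracts 𝒢 A u → owner 𝒢 u ≡ odd →
    ∀ {w} → w ∈ V 𝒢 → w ∈ succ 𝒢 u → w ∈ succ 𝒢 u ∩ A
  opposing-new (inj₁ (eq′ , _)) eq rewrite eq with () ← eq′
  opposing-new (inj₂ (_ , empty)) _ {w} w∈V w∈succ with w ∈? A
  ... | yes w∈A = x∈p∩q⁺ (w∈succ , w∈A)
  ... | no  w∉A = contradiction (w , x∈p∧x∉q⇒x∈p─q (x∈p∩q⁺ (w∈V , w∈succ)) w∉A) empty

  own′ : ∀ {v} → v ∈ V 𝒢 → owner 𝒢 v ≡ even → ∃ λ w → w ∈ σ′ v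
  own′ {v} v∈V eq with v ≟ u
  ... | no v≢u = let w , w∈σ = own strat v∈V eq in w , subst (w ∈_) (sym (σ′-old v≢u)) w∈σ
  ... | yes refl = let w , w∈ = own-new attracts eq in w , subst (w ∈_) (sym σ′-new) w∈

  opposing′ : ∀ {v w} → owner 𝒢 v ≡ odd → 𝒢 ⊢ v ⟶ w → w ∈ σ′ v
  opposing′ {v} {w} eq e@(_ , w∈V , w∈succ) with v ≟ u
  ... | no v≢u = subst (w ∈_) (sym (σ′-old v≢u)) (opposing strat eq e)
  ... | yes refl = subst (w ∈_) (sym σ′-new) (opposing-new attracts eq w∈V w∈succ)

  lift-forced : ∀ {v} → v ∈ A → Forced σ′ B (A ∪ ⁅ u ⁆) v
  lift-forced = Forced-mono (p⊆p∪q _)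
    (λ v∈A {w} → subst (w ∈_) (σ′-old λ { refl → u∉A v∈A })) ∘ forced

  forced′ : ∀ {v} → v ∈ A ∪ ⁅ u ⁆ → Forced σ′ B (A ∪ ⁅ u ⁆) v
  forced′ v∈ with x∈p∪q⁻ A ⁅ u ⁆ v∈
  ... | inj₁ v∈A = lift-forced v∈A
  ... | inj₂ v∈u with refl ← x∈⁅y⁆⇒x≡y u v∈u =
    later v∈ (λ {w} w∈ → lift-forced (p∩q⊆q _ _ (subst (w ∈_) σ′-new w∈)))

-- Outside a saturated `A`, Even has no edge into `A` and Odd always has an edge that avoids it.
unattracted⇒confined : IsParityGame 𝒢 →
  (∀ {v} → v ∈ V 𝒢 → v ∉ A → ¬ Attracts 𝒢 A v) → Confined 𝒢 (V (𝒢 ∖ A))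
unattracted⇒confined {𝒢 = 𝒢} {A = A} live none = record
  { subset = p∩q⊆p _ _
  ; total  = tot
  ; closed = clo
  }
  where
  rest : ∀ {v} → v ∈ V 𝒢 → v ∉ A → v ∈ V (𝒢 ∖ A)
  rest v∈V v∉A = x∈p∩q⁺ (v∈V , x∈p∧x∉q⇒x∈p─q v∈V v∉A)

  clo : ∀ {v w} → owner 𝒢 v ≡ even → v ∈ V (𝒢 ∖ A) → w ∈ V 𝒢 → w ∈ succ 𝒢 v → w ∈ V (𝒢 ∖ A)
  clo {v} {w} eq v∈ w∈V w∈succ = rest w∈V λ w∈A →
    none (p∩q⊆p _ _ v∈) (∈─⇒∉ _ _ (p∩q⊆q (V 𝒢) (V 𝒢 ─ A) v∈))
      (inj₁ (eq , w , x∈p∩q⁺ (w∈succ , w∈A)))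

  tot : ∀ {v} → v ∈ V (𝒢 ∖ A) → ∃ λ w → w ∈ V (𝒢 ∖ A) × w ∈ succ 𝒢 v
  tot {v} v∈ with p∩q⊆p _ _ v∈ | owner 𝒢 v in eq
  ... | v∈V | even = let w , _ , w∈V , w∈succ = live v∈V in w , clo eq v∈ w∈V w∈succ , w∈succ
  ... | v∈V | odd with nonempty? ((V 𝒢 ∩ succ 𝒢 v) ─ A)
  ...   | yes (w , w∈) = let w∈E = p─q⊆p _ _ w∈ in
    w , rest (p∩q⊆p _ _ w∈E) (∈─⇒∉ _ _ w∈) , p∩q⊆q _ _ w∈E
  ...   | no empty = contradiction (inj₂ (eq , empty))
    (none v∈V (∈─⇒∉ _ _ (p∩q⊆q (V 𝒢) (V 𝒢 ─ A) v∈)))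

-- For maximality: the complement of `A` is a trap for Even that avoids `B`, so no set from which
-- Even can force `B` meets it.
attracting⇒attractor : Attracting 𝒢 B A → Confined 𝒢 (V (𝒢 ∖ A)) → IsAttractor even 𝒢 B A
attracting⇒attractor {𝒢 = 𝒢} {B = B} {A = A} a c = attracting⇒reachable a , largest
  where
  largest : ∀ A′ → Reachable even 𝒢 B A′ → A′ ⊆ A
  largest A′ r {v} v∈A′ with v ∈? A
  ... | yes v∈A = v∈A
  ... | no  v∉A = contradiction v∈A′ (confined-reachable-disjoint r c
    (λ w∈ w∈B → ∈─⇒∉ _ _ (p∩q⊆q (V 𝒢) (V 𝒢 ─ A) w∈) (Attracting.B⊆A a w∈B))
    (let v∈V = proj₁ (proj₂ r) v∈A′ in x∈p∩q⁺ (v∈V , x∈p∧x∉q⇒x∈p─q v∈V v∉A)))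

-- Saturation terminates because each round strictly enlarges `A`. That the complement is a trap for
-- Even is returned as well, since the remainder of the subgame must again be one.
attractor-from : IsParityGame 𝒢 → Acc _⊃_ A → Attracting 𝒢 B A →
  ∃ λ A′ → IsAttractor even 𝒢 B A′ × Confined 𝒢 (V (𝒢 ∖ A′))
attractor-from {𝒢 = 𝒢} {A = A} live (acc rec) a
  with any? (λ v → v ∈? V 𝒢 ×-dec ¬? (v ∈? A) ×-dec attracts? 𝒢 A v)
... | yes (u , u∈V , u∉A , attracts) =
  attractor-from live (rec (p⊆p∪q _ , u , q⊆p∪q A _ (x∈⁅x⁆ u) , u∉A))
    (attracting-extend a u∈V u∉A attracts)
... | no none =
  let c = unattracted⇒confined live (λ {v} v∈V v∉A attracts → none (v , v∈V , v∉A , attracts))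
  in A , attracting⇒attractor a c , c

attractor : IsParityGame 𝒢 → ∀ B → B ⊆ V 𝒢 →
  ∃ λ A → IsAttractor even 𝒢 B A × Confined 𝒢 (V (𝒢 ∖ A))
attractor {𝒢 = 𝒢} live B B⊆V = attractor-from live (⊃-wellFounded B) record
  -- Starting with `B` itself, every vertex is `now`, so any strategy will do; all edges together
  -- form one.
  { B⊆A = id ; A⊆V = B⊆V ; σ = succ 𝒢 ↾ V 𝒢 ; strat = allEdges-isStrategy live ; forced = now }

-- Carries the invariant from one layer to the next: the remainder of the subgame contains no vertex
-- of `B`, as those went into `A′`, and therefore avoids `A` too.
confined-remainder : Confined 𝒢 U → Reachable even 𝒢 B A →
  Confined (restrict 𝒢 U) (V (restrict 𝒢 U ∖ A′)) →
  (∀ {v} → v ∈ U → v ∈ B → v ∈ A′) →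
  Confined (𝒢 ∖ A) (V (restrict 𝒢 U ∖ A′))
confined-remainder {U = U} {A′ = A′} c r c′ U∩B⊆A′ = confined-∖ r (confined-trans c c′)
  λ v∈ v∈B → ∈─⇒∉ _ _ (p∩q⊆q U (U ─ A′) v∈) (U∩B⊆A′ (p∩q⊆p _ _ v∈) v∈B)

-- Restricting decompositions to a trap for Even.

mutual

  restrict-decomposition : Confined 𝒢 U → (ℋ : Decomposition d 𝒢) →
    Σ (Decomposition d (restrict 𝒢 U)) λ ℋ′ → tree ℋ Embeds tree ℋ′
  restrict-decomposition {𝒢 = 𝒢} {U = U} {d = d} c ⟨ A , att , ls ⟩ =
    let A′ , att′ , c′ = attractor (confined-isParityGame c)
                           (priorityVertices (restrict 𝒢 U) d) (p∩q⊆p _ _)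
        -- Restriction keeps priorities, so the vertices of `U` with priority `d` are among the
        -- targets of `A′`.
        ls′ , e = restrict-layers (confined-remainder c (proj₁ att) c′
                    λ v∈U v∈B → proj₁ (proj₁ att′) (x∈p∩q⁺ (v∈U , p∩q⊆q (V 𝒢) _ v∈B))) ls
    in ⟨ A′ , att′ , ls′ ⟩ , e

  -- Both `𝒢` and `U` vary along the recursion: they stand for what is left of the game and of the
  -- subgame.
  restrict-layers : Confined 𝒢 U → (ls : Layers d 𝒢) →
    Σ (Layers d (restrict 𝒢 U)) λ ls′ → node (subtrees ls) Embeds node (subtrees ls′)
  restrict-layers c (done empty) = done (λ (v , v∈U) → empty (v , subset c v∈U)) , trivial
  restrict-layers {𝒢 = 𝒢} {U = U} c (layer S _ trap bound ℋ A att ls) with nonempty? (U ∩ S)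
  ... | no U∩S=∅ =
    -- The layer is dropped: `U` avoids `A` and passes unchanged to `𝒢 ∖ A`, while the subtree of
    -- `ℋ` stays unmatched.
    let ls′ , e = restrict-layers (confined-∖ (proj₁ att) c
                    λ {v} v∈U v∈S → U∩S=∅ (v , x∈p∩q⁺ (v∈U , v∈S))) ls
    in ls′ , embeds-skip e
  ... | yes ne =
    let A′ , att′ , c′ = attractor (confined-isParityGame c) (U ∩ S) (p∩q⊆p _ _)
        -- `ℋ` decomposes `𝒢 ⋒ S`, so the recursive call needs a trap for Even in that game.
        cS       = confined-∩-trap c trap
        ℋ′ , e   = restrict-decomposition cS ℋ
        ls′ , es = restrict-layers (confined-remainder c (proj₁ att) c′
                     λ v∈U v∈S → proj₁ (proj₁ att′) (x∈p∩q⁺ (v∈U , v∈S))) ls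
    in layer (U ∩ S) ne (trap-restrict c trap) (bound ∘ subset cS) ℋ′ A′ att′ ls′ , embeds-cons e es

theorem14 : ∀ {n : ℕ} (𝒢 : Structure n) → IsParityGame 𝒢 →
    (T : Subset n) → IsTrapFor even 𝒢 T →
    (d : ℕ) → 2 ∣ d → PrioritiesAtMost d 𝒢 →
    (ℋ : Decomposition d 𝒢) →
    Σ (Decomposition d (𝒢 ⋒ T)) λ ℋ′ → tree ℋ Embeds tree ℋ′
-- By definition `restrict 𝒢 (V 𝒢 ∩ T)` is `𝒢 ⋒ T`.
theorem14 𝒢 live T trap d _ _ ℋ = restrict-decomposition (trap⇒confined live trap) ℋ
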